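{- Let $b\ge 2$ and let $N$ be a $b$-wMRH number with $k$ base-$b$ digits and with multiplicative extra term $A\ge 1$. Then $k\le A+4$ if $b\ge 6$, and $k\le A+5$ if $2\le b\le 5$.
   Context: Fix a base $b\ge 2$. $s_b(N)$ is the sum of the base-$b$ digits of $N$. For a positive integer $X$, its reversal $X^R$ is the integer whose base-$b$ representation is that of $X$ written in reverse order (leading zeros of the result are dropped). A positive integer $N$ is a $b$-wMRH number if there exists an integer $A\ge 0$, called a multiplicative extra term of $N$, such that $N=(A+s_b(N))\cdot(A+s_b(N))^R$. -}

module Defs where

open import Data.Digit using (Expansion; toDigits; fromDigits)
open import Data.Fin.Base using (toℕ)
open import Data.List.Base using (length; map; reverse)
open import Data.Nat.Base using (ℕ; _+_; _*_; _≤_; _<_)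
open import Data.Nat.ListAction using (sum)
open import Data.Nat.Properties using (_≤?_)
open import Data.Product.Base using (∃; _×_; proj₁)
open import Relation.Binary.PropositionalEquality using (_≡_)
open import Relation.Nullary.Decidable using (fromWitness)

module _ (b : ℕ) (2≤b : 2 ≤ b) where

  -- Least significant digit first, with no zero digit at the end of the
  -- list, except that 0 is represented by a single digit 0.
  digits : ℕ → Expansion b
  digits n = proj₁ (toDigits b {fromWitness {a? = 2 ≤? b} 2≤b} n)

  numDigits : ℕ → ℕ
  numDigits n = length (digits n)

  digitSum : ℕ → ℕ
  digitSum n = sum (map toℕ (digits n))

  -- The value of an expansion does not depend on leading zeros, so taking
  -- the value of the reversed expansion drops them.
  reversal : ℕ → ℕ
  reversal n = fromDigits (reverse (digits n))

  IsMultiplicativeExtraTerm : ℕ → ℕ → Set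
  IsMultiplicativeExtraTerm N A =
    N ≡ (A + digitSum N) * reversal (A + digitSum N)

  IsWMRH : ℕ → Set
  IsWMRH N = 0 < N × ∃ λ A → IsMultiplicativeExtraTerm N A

{-# OPTIONS --safe #-}

-- Write M = A + s_b(N), so that N = M · Mᴿ. A number with the same number of
-- digits as M is less than b M, hence bᵏ ≤ b N < (b M)², while
-- M ≤ A + (b − 1) k. If k were at least A + d, this would give
-- bᵏ⁻² < (b k − d)², and for d = 5 (resp. 6) the left side is too large
-- already for the least possible k. The only exceptions are b = 2 and
-- k = 7, 8, 9, where the products M · Mᴿ are inspected one by one.
module Submission where

open import Defs
open import Data.Digit using (Expansion; fromDigits; toDigits)
open import Data.Empty using (⊥)
open import Data.Fin.Base using (Fin; zero; suc; toℕ; fromℕ<)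
open import Data.Fin.Properties using (all?; toℕ<n; toℕ-fromℕ<)
open import Data.List.Base using ([]; _∷_; length; map; reverse)
open import Data.List.Properties using (length-reverse)
open import Data.Nat.Base
open import Data.Nat.DivMod using (result; _divMod_)
open import Data.Nat.Induction using (Acc; acc; <′-Rec; <′-wellFounded′)
open import Data.Nat.ListAction using (sum)
open import Data.Nat.Properties
open import Data.Nat.Tactic.RingSolver using (solve-∀)
open import Data.Product.Base using (∃; _×_; _,_; proj₁)
open import Induction.WellFounded using (module Some)
open import Relation.Binary.PropositionalEquality
  using (_≡_; refl; sym; trans; cong; subst)
open import Relation.Nullary.Decidable using (from-yes)

open ≤-Reasoning

-- Values of digit expansions

fromDigits-< : ∀ {b} (ds : Expansion b) → fromDigits ds < b ^ length ds
fromDigits-<     []       = ≤-refl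
fromDigits-< {b} (d ∷ ds) = begin-strict
  toℕ d + fromDigits ds * b  <⟨ +-monoˡ-< _ (toℕ<n d) ⟩
  suc (fromDigits ds) * b    ≤⟨ *-monoˡ-≤ b (fromDigits-< ds) ⟩
  b ^ length ds * b          ≡⟨ *-comm (b ^ length ds) b ⟩
  b * b ^ length ds          ∎

sum-digits-≤ : ∀ {b} (ds : Expansion b) →
               sum (map toℕ ds) + length ds ≤ b * length ds
sum-digits-≤ {b} []       = z≤n
sum-digits-≤ {b} (d ∷ ds) = begin
  toℕ d + sum (map toℕ ds) + suc (length ds)    ≡⟨ shuffle (toℕ d) _ _ ⟩
  suc (toℕ d) + (sum (map toℕ ds) + length ds)  ≤⟨ +-mono-≤ (toℕ<n d) (sum-digits-≤ ds) ⟩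
  b + b * length ds                             ≡⟨ *-suc b (length ds) ⟨
  b * suc (length ds)                           ∎
  where
  shuffle : ∀ x y z → x + y + suc z ≡ suc x + (y + z)
  shuffle = solve-∀

-- Expansions computed by toDigits

Digits : ℕ → ℕ → Set
Digits b n = ∃ λ (ds : Expansion b) → fromDigits ds ≡ n

-- A record, so that unification can infer the list from the type.
record LengthBound {b} (n : ℕ) (ds : Expansion b) : Set where
  field
    bound : 0 < n → b ^ length ds ≤ b * n

open LengthBound

-- Positivity enters here: `b ^ 1` is at most `b * n` because `1 ≤ n`.
single-lengthBound : ∀ {b n} (r : Fin b) → LengthBound n (r ∷ [])
single-lengthBound {b} _ .bound = *-monoʳ-≤ b

-- A further digit multiplies the power by `b` and the number by at least `b`.
cons-lengthBound : ∀ {b} (r : Fin b) q {ds} → LengthBound (suc q) ds →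
                   LengthBound (toℕ r + suc q * b) (r ∷ ds)
cons-lengthBound {b} r q {ds} h .bound _ = *-monoʳ-≤ b (begin
  b ^ length ds        ≤⟨ h .bound z<s ⟩
  b * suc q            ≡⟨ *-comm b (suc q) ⟩
  suc q * b            ≤⟨ m≤n+m _ (toℕ r) ⟩
  toℕ r + suc q * b    ∎)

Step : ℕ → Set
Step b = ∀ n → <′-Rec (Digits b) n → Digits b n

PreservesLengthBound : ∀ {b} → Step b → Set
PreservesLengthBound {b} f =
  ∀ n (rec : <′-Rec (Digits b) n) →
  (∀ {m} (m<n : m <′ n) → LengthBound m (proj₁ (rec m<n))) →
  LengthBound n (proj₁ (f n rec))

-- Well-founded recursion unfolds along the accessibility proof, so the induction is on that proof.
wfRec-lengthBound :
  ∀ {b} {f : Step b} → PreservesLengthBound f →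
  ∀ {n} (a : Acc _<′_ n) {m} (m<n : m <′ n) →
  LengthBound m (proj₁ (Some.wfRecBuilder (Digits b) f n a m<n))
wfRec-lengthBound pres (acc rs) m<n =
  pres _ _ (wfRec-lengthBound pres (rs m<n))

-- The step function inside toDigits is private. After two unfoldings of
-- toDigits it is visible as an argument of a stuck recursive call, and there
-- unification can read it off. For that the accessibility proof of the call
-- must not depend on an unsolved metavariable, which is why stuckAcc has to
-- agree with the first steps of the inequality proof used by toDigits; `rest`
-- stands for its remaining steps.
stuckAcc : ∀ k r x → 2 + x + (r + (x + (1 + x) * k)) ≡ r + (1 + x) * 2+ k →
           Acc _<′_ (1 + x)
stuckAcc k r x rest = <′-wellFounded′ _ (≤⇒≤′ (begin
  2 + x                          ≤⟨ m≤m+n _ _ ⟩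
  2 + x + (x + (1 + x) * k + r)  ≡⟨ cong ((2 + x) +_) (+-comm _ r) ⟩
  equals rest))

stuckCall : ∀ k → Step (2+ k) → ∀ r x →
            2 + x + (r + (x + (1 + x) * k)) ≡ r + (1 + x) * 2+ k →
            <′-Rec (Digits (2+ k)) (1 + x)
stuckCall k f r x rest =
  Some.wfRecBuilder (Digits (2+ k)) f (1 + x) (stuckAcc k r x rest)

-- The step function also takes the number originally passed to toDigits as
-- a hidden argument. That number is toℕ r + (1 + q) * 2+ k with
-- 1 + q = toℕ r′ + (1 + x) * 2+ k, and 1 + q is a successor definitionally only
-- once r′ is split into zero (step₀) and suc (step₊).
mutual
  step₀ : ∀ k (r : Fin (2+ k)) (x : ℕ) → Step (2+ k)
  step₀ k r x = _

  step₊ : ∀ k (r : Fin (2+ k)) (r′ : Fin (1 + k)) (x : ℕ) → Step (2+ k)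
  step₊ k r r′ x = _

  private
    -- Checking this solves the two underscores above.
    determine-steps : ∀ k n →
      proj₁ (toDigits (2+ k) n) ≡ proj₁ (toDigits (2+ k) n)
    determine-steps k n with n divMod 2+ k
    ... | result zero r _ = refl
    ... | result (suc q) r refl with suc q divMod 2+ k
    ...   | result zero r′ _ = refl
    ...   | result (suc x) zero refl =
      cong (λ p → r ∷ zero ∷ proj₁ p)
        (refl {x = stuckCall k (step₀ k r x) (toℕ r) (1 + k + x * 2+ k) _ _})
    ...   | result (suc x) (suc r′) refl =
      cong (λ p → r ∷ suc r′ ∷ proj₁ p)
        (refl {x = stuckCall k (step₊ k r r′ x) (toℕ r) (toℕ r′ + suc x * 2+ k) _ _})

step₀-preserves : ∀ k r x → PreservesLengthBound (step₀ k r x)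
step₀-preserves k _ _ n rec ih with n divMod 2+ k
... | result zero r _       = single-lengthBound r
... | result (suc q) r refl = cons-lengthBound r q (ih _)

step₊-preserves : ∀ k r r′ x → PreservesLengthBound (step₊ k r r′ x)
step₊-preserves k _ _ _ n rec ih with n divMod 2+ k
... | result zero r _       = single-lengthBound r
... | result (suc q) r refl = cons-lengthBound r q (ih _)

-- The cases follow `determine-steps`: the two lowest digits are treated by hand, the others through
-- the step function found there.
toDigits-lengthBound : ∀ k n → LengthBound n (proj₁ (toDigits (2+ k) n))
toDigits-lengthBound k n with n divMod 2+ k
... | result zero r _ = single-lengthBound r
... | result (suc q) r refl with suc q divMod 2+ k
...   | result zero r′ _ = cons-lengthBound r q (single-lengthBound r′)
...   | result (suc x) zero refl =
  cons-lengthBound r _ (cons-lengthBound zero x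
    (wfRec-lengthBound (step₀-preserves k r x)
      (stuckAcc k (toℕ r) (1 + k + x * 2+ k) _) _))
...   | result (suc x) (suc r′) refl =
  cons-lengthBound r _ (cons-lengthBound (suc r′) x
    (wfRec-lengthBound (step₊-preserves k r r′ x)
      (stuckAcc k (toℕ r) (toℕ r′ + suc x * 2+ k) _) _))

^-numDigits-≤ : ∀ b (2≤b : 2 ≤ b) {n} → 0 < n → b ^ numDigits b 2≤b n ≤ b * n
^-numDigits-≤ 1      (s≤s ())
^-numDigits-≤ (2+ k) _ {n} = toDigits-lengthBound k n .bound

-- Reversing keeps the length of the digit list, and the length alone bounds the value.
reversal-< : ∀ b (2≤b : 2 ≤ b) {n} → 0 < n → reversal b 2≤b n < b * n
reversal-< b 2≤b {n} 0<n = begin-strict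
  reversal b 2≤b n             <⟨ fromDigits-< (reverse ds) ⟩
  b ^ length (reverse ds)      ≡⟨ cong (b ^_) (length-reverse ds) ⟩
  b ^ numDigits b 2≤b n        ≤⟨ ^-numDigits-≤ b 2≤b 0<n ⟩
  b * n                        ∎
  where ds = digits b 2≤b n

-- Squares against exponentials

-- Under 5 b ≤ 2 c each step multiplies c + b * i by at most 7/5, and
-- (7/5)² < 2 ≤ b.
square-≤-^ : ∀ {b c e} → 2 ≤ b → 5 * b ≤ 2 * c → c * c ≤ b ^ e →
             ∀ i → (c + b * i) * (c + b * i) ≤ b ^ (e + i)
square-≤-^ {b} {c} {e} 2≤b 5b≤2c base zero
  rewrite *-zeroʳ b | +-identityʳ c | +-identityʳ e = base
square-≤-^ {b} {c} {e} 2≤b 5b≤2c base (suc i)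
  rewrite +-suc e i = *-cancelˡ-≤ 25 (begin
  -- The factor 25 clears the denominator of (7/5)².
  25 * ((c + b * suc i) * (c + b * suc i))  ≡⟨ expand b c i ⟩
  (5 * x + 5 * b) * (5 * x + 5 * b)         ≤⟨ *-mono-≤ 5x+5b≤7x 5x+5b≤7x ⟩
  (5 * x + 2 * x) * (5 * x + 2 * x)         ≡⟨ collect x ⟩
  49 * (x * x)                              ≤⟨ *-monoˡ-≤ (x * x) 49≤25b ⟩
  25 * b * (x * x)                          ≡⟨ *-assoc 25 b (x * x) ⟩
  25 * (b * (x * x))                        ≤⟨ *-monoʳ-≤ 25 (*-monoʳ-≤ b (square-≤-^ {b} {c} {e} 2≤b 5b≤2c base i)) ⟩
  25 * (b * b ^ (e + i))                    ∎)
  where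
  x = c + b * i
  5x+5b≤7x : 5 * x + 5 * b ≤ 5 * x + 2 * x
  5x+5b≤7x = +-monoʳ-≤ (5 * x) (≤-trans 5b≤2c (*-monoʳ-≤ 2 (m≤m+n c (b * i))))
  49≤25b : 49 ≤ 25 * b
  49≤25b = ≤-trans (n≤1+n 49) (*-monoʳ-≤ 25 2≤b)
  expand : ∀ b c i → 25 * ((c + b * suc i) * (c + b * suc i)) ≡
    (5 * (c + b * i) + 5 * b) * (5 * (c + b * i) + 5 * b)
  expand = solve-∀
  collect : ∀ x → (5 * x + 2 * x) * (5 * x + 2 * x) ≡ 49 * (x * x)
  collect = solve-∀

-- Multiplicative extra terms

-- The digit sum is at most (b - 1) k and A at most k - d; this is M ≤ b k - d without subtraction.
factor-≤ : ∀ b (2≤b : 2 ≤ b) N A {d} → A + d ≤ numDigits b 2≤b N →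
           A + digitSum b 2≤b N + d ≤ b * numDigits b 2≤b N
factor-≤ b 2≤b N A {d} A+d≤k = begin
  A + s + d                    ≡⟨ shuffle A s d ⟩
  s + (A + d)                  ≤⟨ +-monoʳ-≤ s A+d≤k ⟩
  s + numDigits b 2≤b N        ≤⟨ sum-digits-≤ (digits b 2≤b N) ⟩
  b * numDigits b 2≤b N        ∎
  where
  s = digitSum b 2≤b N
  shuffle : ∀ a s d → a + s + d ≡ s + (a + d)
  shuffle = solve-∀

module _ (b : ℕ) (2≤b : 2 ≤ b) {N A : ℕ} (0<N : 0 < N)
         (extra : IsMultiplicativeExtraTerm b 2≤b N A) where

  private
    M = A + digitSum b 2≤b N

    0<M : 0 < M
    0<M = n≢0⇒n>0 λ M≡0 →
      >⇒≢ 0<N (trans extra (cong (_* reversal b 2≤b M) M≡0))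

  ^-numDigits-<-square : b ^ numDigits b 2≤b N < b * (b * (M * M))
  ^-numDigits-<-square = begin-strict
    b ^ numDigits b 2≤b N         ≤⟨ ^-numDigits-≤ b 2≤b 0<N ⟩
    b * N                         ≡⟨ cong (b *_) extra ⟩
    b * (M * reversal b 2≤b M)    <⟨ *-monoʳ-< b {{>-nonZero (≤-trans z<s 2≤b)}}
                                       (*-monoʳ-< M {{>-nonZero 0<M}} (reversal-< b 2≤b 0<M)) ⟩
    b * (M * (b * M))             ≡⟨ cong (b *_) (swap M b) ⟩
    b * (b * (M * M))             ∎
    where
    swap : ∀ m b → m * (b * m) ≡ b * (m * m)
    swap = solve-∀

  -- c = b (2 + e) − d is the bound for M at the least number 2 + e of digits.
  too-many-digits :
    ∀ {d} e c i → numDigits b 2≤b N ≡ 2 + e + i → A + d ≤ 2 + e + i →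
    c + d ≡ b * (2 + e) → 5 * b ≤ 2 * c → c * c ≤ b ^ e → ⊥
  too-many-digits {d} e c i k≡ A+d≤k c+d≡ 5b≤2c base =
    <-irrefl refl (begin-strict
      b ^ (2 + e + i)                        ≡⟨ cong (b ^_) k≡ ⟨
      b ^ numDigits b 2≤b N                  <⟨ ^-numDigits-<-square ⟩
      b * (b * (M * M))                      ≤⟨ *-monoʳ-≤ b (*-monoʳ-≤ b (*-mono-≤ M≤ M≤)) ⟩
      b * (b * ((c + b * i) * (c + b * i)))  ≤⟨ *-monoʳ-≤ b (*-monoʳ-≤ b (square-≤-^ {c = c} {e} 2≤b 5b≤2c base i)) ⟩
      b ^ (2 + e + i)                        ∎)
    where
    shuffle : ∀ c y d → c + d + y ≡ c + y + d
    shuffle = solve-∀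
    M≤ : M ≤ c + b * i
    M≤ = +-cancelʳ-≤ d M (c + b * i) (begin
      M + d                        ≤⟨ factor-≤ b 2≤b N A (subst (A + d ≤_) (sym k≡) A+d≤k) ⟩
      b * numDigits b 2≤b N        ≡⟨ cong (b *_) k≡ ⟩
      b * (2 + e + i)              ≡⟨ *-distribˡ-+ b (2 + e) i ⟩
      b * (2 + e) + b * i          ≡⟨ cong (_+ b * i) c+d≡ ⟨
      c + d + b * i                ≡⟨ shuffle c (b * i) d ⟩
      c + b * i + d                ∎)

-- With k = 7 + i binary digits, N is at least 2^(6 + i), while M ≤ 2 k - 6 = 8 + 2 i. The finitely
-- many candidates for M are checked by evaluation.
binary-products : (2≤2 : 2 ≤ 2) (i : Fin 3) (m : Fin (9 + 2 * toℕ i)) →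
                  toℕ m * reversal 2 2≤2 (toℕ m) < 2 ^ (6 + toℕ i)
binary-products _ = from-yes (all? {n = 3} λ i → all? {n = 9 + 2 * toℕ i} λ m →
  toℕ m * reversal 2 (s≤s (s≤s z≤n)) (toℕ m) <? 2 ^ (6 + toℕ i))

too-many-binary-digits :
  (2≤2 : 2 ≤ 2) {N A : ℕ} → 0 < N → IsMultiplicativeExtraTerm 2 2≤2 N A →
  (i : Fin 3) → numDigits 2 2≤2 N ≡ 7 + toℕ i → A + 6 ≤ 7 + toℕ i → ⊥
too-many-binary-digits 2≤2 {N} {A} 0<N extra i k≡ A+6≤k =
  <⇒≱ (*-monoʳ-< 2 N<) (begin
    2 ^ (7 + toℕ i)         ≡⟨ cong (2 ^_) k≡ ⟨
    2 ^ numDigits 2 2≤2 N   ≤⟨ ^-numDigits-≤ 2 2≤2 0<N ⟩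
    2 * N                   ∎)
  where
  M = A + digitSum 2 2≤2 N
  double : ∀ j → 2 * (7 + j) ≡ 8 + 2 * j + 6
  double = solve-∀
  M< : M < 9 + 2 * toℕ i
  M< = s≤s (+-cancelʳ-≤ 6 M (8 + 2 * toℕ i) (begin
    M + 6                    ≤⟨ factor-≤ 2 2≤2 N A (subst (A + 6 ≤_) (sym k≡) A+6≤k) ⟩
    2 * numDigits 2 2≤2 N    ≡⟨ cong (2 *_) k≡ ⟩
    2 * (7 + toℕ i)          ≡⟨ double (toℕ i) ⟩
    8 + 2 * toℕ i + 6        ∎))
  N< : N < 2 ^ (6 + toℕ i)
  N< = subst (_< 2 ^ (6 + toℕ i)) (sym extra)
    (subst (λ m → m * reversal 2 2≤2 m < 2 ^ (6 + toℕ i)) (toℕ-fromℕ< M<)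
      (binary-products 2≤2 i (fromℕ< M<)))

-- The two bounds on the number of digits

module _ {N A : ℕ} (0<N : 0 < N) (1≤A : 1 ≤ A) where

  numDigits-≤-large : ∀ b (2≤b : 2 ≤ b) → 6 ≤ b →
    IsMultiplicativeExtraTerm b 2≤b N A → numDigits b 2≤b N ≤ A + 4
  numDigits-≤-large b 2≤b 6≤b extra = ≮⇒≥ λ A+4<k →
    let A+5≤k   = subst (_≤ numDigits b 2≤b N) (sym (+-suc A 4)) A+4<k
        i , k≡  = m≤n⇒∃[o]m+o≡n (≤-trans (+-monoˡ-≤ 5 1≤A) A+5≤k)
        j , b≡  = m≤n⇒∃[o]m+o≡n 6≤b
    in contradict j (sym b≡) i (sym k≡) (subst (A + 5 ≤_) (sym k≡) A+5≤k)
    where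
    c+5≡ : ∀ j → 31 + 6 * j + 5 ≡ (6 + j) * 6
    c+5≡ = solve-∀
    5b+≡2c : ∀ j → 5 * (6 + j) + (32 + 7 * j) ≡ 2 * (31 + 6 * j)
    5b+≡2c = solve-∀
    -- For c = 6 b - 5 the gap b² - c is (b - 1)(b - 5), taken at b = 6 + j.
    c+≡b² : ∀ j → 31 + 6 * j + (5 + 6 * j + j * j) ≡ (6 + j) * (6 + j)
    c+≡b² = solve-∀
    c≤b² : ∀ j → 31 + 6 * j ≤ (6 + j) * (6 + j)
    c≤b² j = m+n≤o⇒m≤o _ (≤-reflexive (c+≡b² j))
    ^4 : ∀ b → b * b * (b * b) ≡ b * (b * (b * (b * 1)))
    ^4 = solve-∀
    contradict : ∀ j → b ≡ 6 + j → ∀ i → numDigits b 2≤b N ≡ 6 + i →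
                 A + 5 ≤ 6 + i → ⊥
    -- As 1 ≤ A, the least k is 6, so e = 4 and c = 6 b - 5; squaring c ≤ b² gives c² ≤ b⁴.
    contradict j refl i k≡ A+5≤k =
      too-many-digits b 2≤b 0<N extra 4 (31 + 6 * j) i k≡ A+5≤k (c+5≡ j)
        (m+n≤o⇒m≤o _ (≤-reflexive (5b+≡2c j)))
        (≤-trans (*-mono-≤ (c≤b² j) (c≤b² j)) (≤-reflexive (^4 b)))

  numDigits-≤-small : ∀ b (2≤b : 2 ≤ b) → b ≤ 5 →
    IsMultiplicativeExtraTerm b 2≤b N A → numDigits b 2≤b N ≤ A + 5
  numDigits-≤-small b 2≤b b≤5 extra = ≮⇒≥ λ A+5<k →
    let A+6≤k   = subst (_≤ numDigits b 2≤b N) (sym (+-suc A 5)) A+5<k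
        i , k≡  = m≤n⇒∃[o]m+o≡n (≤-trans (+-monoˡ-≤ 6 1≤A) A+6≤k)
    in contradict b 2≤b b≤5 extra i (sym k≡) (subst (A + 6 ≤_) (sym k≡) A+6≤k)
    where
    contradict : ∀ b (2≤b : 2 ≤ b) → b ≤ 5 →
      IsMultiplicativeExtraTerm b 2≤b N A →
      ∀ i → numDigits b 2≤b N ≡ 7 + i → A + 6 ≤ 7 + i → ⊥
    contradict 0 () _ _
    contradict 1 (s≤s ()) _ _
    contradict 2 2≤b _ extra 0 = too-many-binary-digits 2≤b {A = A} 0<N extra zero
    contradict 2 2≤b _ extra 1 = too-many-binary-digits 2≤b {A = A} 0<N extra (suc zero)
    contradict 2 2≤b _ extra 2 = too-many-binary-digits 2≤b {A = A} 0<N extra (suc (suc zero))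
    -- From k = 10 on the general estimate works, with c = 20 - 6. For k = 7, 8, 9 the squares 64,
    -- 100, 144 exceed 32, 64, 128.
    contradict 2 2≤b _ extra (suc (suc (suc i))) k≡ A+6≤k =
      too-many-digits 2 2≤b {A = A} 0<N extra 8 14 i k≡ A+6≤k refl
        (from-yes (10 ≤? 28)) (from-yes (196 ≤? 256))
    -- For b = 3, 4, 5 the least k is 7, so e = 5 and c = 7 b - 6.
    contradict 3 2≤b _ extra i k≡ A+6≤k =
      too-many-digits 3 2≤b {A = A} 0<N extra 5 15 i k≡ A+6≤k refl
        (from-yes (15 ≤? 30)) (from-yes (225 ≤? 243))
    contradict 4 2≤b _ extra i k≡ A+6≤k =
      too-many-digits 4 2≤b {A = A} 0<N extra 5 22 i k≡ A+6≤k refl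
        (from-yes (20 ≤? 44)) (from-yes (484 ≤? 1024))
    contradict 5 2≤b _ extra i k≡ A+6≤k =
      too-many-digits 5 2≤b {A = A} 0<N extra 5 29 i k≡ A+6≤k refl
        (from-yes (25 ≤? 58)) (from-yes (841 ≤? 3125))
    contradict (suc (suc (suc (suc (suc (suc _)))))) _
      (s≤s (s≤s (s≤s (s≤s (s≤s ()))))) _

mainTheorem19 : (b : ℕ) (2≤b : 2 ≤ b) (N k A : ℕ) →
    IsWMRH b 2≤b N →
    numDigits b 2≤b N ≡ k →
    IsMultiplicativeExtraTerm b 2≤b N A →
    1 ≤ A →
    (6 ≤ b → k ≤ A + 4) × (b ≤ 5 → k ≤ A + 5)
mainTheorem19 b 2≤b N _ A (0<N , _) refl extra 1≤A =
  (λ 6≤b → numDigits-≤-large 0<N 1≤A b 2≤b 6≤b extra) ,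
  (λ b≤5 → numDigits-≤-small 0<N 1≤A b 2≤b b≤5 extra)
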